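{- For each integer $l\ge1$, the sequence $X(l)=(a_j)_{j\ge1}$ with $a_j=\nu_2(A_{l,l+j-1})$ is $s$-simple with $s=2^{1+\nu_2(l)}$.
   Context: $A_{l,m}=\frac{l!\,m!}{2^{m-l}}\sum_{k=l}^{m}2^{k}\binom{2m-2k}{m-k}\binom{m+k}{k}\binom{k}{l}$ for $0\le l\le m$; $\nu_2$ is the $2$-adic valuation. A sequence $(a_j)_{j\ge1}$ has block structure with block length $s\ge2$ if for every $t\ge0$, $a_{st+1}=a_{st+2}=\cdots=a_{s(t+1)}$; it is called $s$-simple if $s$ is the largest block length for which this holds. -}

module Defs where

open import Data.Integer.Base as ℤ using (ℤ; +_)
open import Data.List.Base using (applyUpTo)
open import Data.Nat.Base
open import Data.Nat.Combinatorics using (_C_)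
open import Data.Nat.Divisibility
open import Data.Nat.DivMod using (m/n<m; m/n*n≡m; m≥n⇒m/n>0)
open import Data.Nat.ListAction using (sum)
open import Data.Nat.Properties
open import Data.Product.Base using (_×_; _,_)
open import Data.Rational.Base as ℚ using (ℚ; ↥_; ↧ₙ_)
open import Level using (Level)
open import Relation.Binary.PropositionalEquality
open import Relation.Nullary using (¬_; yes; no)

private variable
  a : Level
  X : Set a

-- Halves n for as long as it is even, at most `fuel` times.
halvings : (fuel n : ℕ) → ℕ
halvings zero       n = 0
halvings (suc fuel) n with 2 ∣? n
... | yes _ = suc (halvings fuel (n / 2))
... | no  _ = 0

-- The fuel n suffices for n ≥ 1 (see ν₂-divides and ν₂-maximal); ν₂ 0 = 0
-- is a junk value.
ν₂ : ℕ → ℕ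
ν₂ n = halvings n n

ν₂-divides : ∀ n → 2 ^ ν₂ n ∣ n
ν₂-divides n = go n n
  where
  go : ∀ f n → 2 ^ halvings f n ∣ n
  go zero    n = 1∣ n
  go (suc f) n with 2 ∣? n
  ... | no  _   = 1∣ n
  ... | yes 2∣n = subst (2 ^ suc (halvings f (n / 2)) ∣_)
                    (trans (*-comm 2 (n / 2)) (m/n*n≡m 2∣n))
                    (*-monoʳ-∣ 2 (go f (n / 2)))

ν₂-maximal : ∀ n .{{_ : NonZero n}} → ¬ (2 ^ suc (ν₂ n) ∣ n)
ν₂-maximal n = go n n ≤-refl
  where
  go : ∀ f n .{{_ : NonZero n}} → n ≤ f → ¬ (2 ^ suc (halvings f n) ∣ n)
  go zero    (suc _) ()
  go (suc f) n n≤1+f d with 2 ∣? n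
  ... | no  2∤n = 2∤n d
  ... | yes 2∣n = go f (n / 2) {{>-nonZero (m≥n⇒m/n>0 (∣⇒≤ 2∣n))}}
                    (s≤s⁻¹ (<-≤-trans (m/n<m n 2 (s≤s (s≤s z≤n))) n≤1+f))
                    (*-cancelˡ-∣ 2 (subst (2 ^ suc (suc (halvings f (n / 2))) ∣_)
                      (sym (trans (*-comm 2 (n / 2)) (m/n*n≡m 2∣n))) d))

-- ν₂ (p / q) = ν₂ p − ν₂ q, an integer which may be negative; junk at 0
-- (but A l m below is positive whenever l ≤ m).
ν₂ℚ : ℚ → ℤ
ν₂ℚ q = + ν₂ ℤ.∣ ↥ q ∣ ℤ.- + ν₂ (↧ₙ q)

-- f l + f (l + 1) + ⋯ + f m, empty when l > m.
sumFromTo : ℕ → ℕ → (ℕ → ℕ) → ℕ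
sumFromTo l m f = sum (applyUpTo (λ i → f (l + i)) (suc m ∸ l))

-- Meaningful for l ≤ m, in which case no subtraction below is truncated.
A : ℕ → ℕ → ℚ
A l m = ((+ (l ! * m !)) ℚ./ (2 ^ (m ∸ l))) {{m^n≢0 2 (m ∸ l)}}
        ℚ.* ((+ S) ℚ./ 1)
  where
  S : ℕ
  S = sumFromTo l m λ k →
        2 ^ k * ((2 * m ∸ 2 * k) C (m ∸ k)) * ((m + k) C k) * (k C l)

-- Sequences (a_j)_{j ≥ 1} are functions on ℕ whose value at 0 is never used.

HasBlockStructure : (ℕ → X) → ℕ → Set _
HasBlockStructure a s =
  2 ≤ s × (∀ t i → 1 ≤ i → i ≤ s → a (s * t + i) ≡ a (s * t + 1))

IsSimple : (ℕ → X) → ℕ → Set _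
IsSimple a s = HasBlockStructure a s × (∀ r → HasBlockStructure a r → r ≤ s)

seqX : ℕ → ℕ → ℤ
seqX l j = ν₂ℚ (A l (l + j ∸ 1))

{-# OPTIONS --safe #-}

-- Put S_l = Σ_k c_k (k choose l) with c_k = 2^k (2m-2k choose m-k) (m+k choose k).
-- The ratio c_{k+1} / c_k is rational in k, which makes the polynomial
-- Σ_l S_l x^l = Σ_k c_k (1 + x)^k satisfy a second order differential equation;
-- on coefficients it is a three-term recurrence in l. In terms of
-- F_l = l! m! S_l = 2^(m-l) A_{l,m} and b_l = (m - l)! F_l / (2^m (l + m)!) it reads
--   b_l + (m - l - 1)(m + l + 2) b_{l+2} = (2m + 1) b_{l+1},   b_m = 1,
-- and (m - l - 1)(m + l + 2) is even, so every b_l is an odd integer by downward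
-- induction. Hence ν₂(A_{l,l+i}) = l + ν₂((2l + i)!) - ν₂(i!), and two consecutive
-- terms a_j, a_{j+1} agree iff ν₂(2l + j) = ν₂(j). With s = 2^(1 + ν₂ l), this holds
-- when s does not divide j and fails for j = s, as 2l / s is odd.
module Submission where

open import Defs
open import Data.Empty using (⊥-elim)
open import Data.Integer.Base as ℤ using (ℤ)
import Data.Integer.Properties as ℤ
import Data.Integer.Tactic.RingSolver as ℤSolver
open import Data.List.Base using (applyUpTo)
open import Data.Nat.Base
open import Data.Nat.Combinatorics using (_C_; nC1≡n; nCn≡1; nCk+nC[k+1]≡[n+1]C[k+1]; nCk≡n!/k![n-k]!; k>n⇒nCk≡0; k![n∸k]!∣n!)
open import Data.Nat.Divisibility
open import Data.Nat.DivMod using (m/n*n≡m)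
open import Data.Nat.ListAction using (sum)
open import Data.Nat.Primality using (prime[2]; euclidsLemma)
open import Data.Nat.Properties
open import Data.Nat.Tactic.RingSolver using (solve-∀)
open import Data.Product.Base using (∃-syntax; _×_; _,_)
open import Data.Rational.Base as ℚ using (mkℚ; ↥_; ↧ₙ_; toℚᵘ)
import Data.Rational.Properties as ℚ
open import Data.Rational.Unnormalised.Base as ℚᵘ using (mkℚᵘ; *≡*)
import Data.Rational.Unnormalised.Properties as ℚᵘ
open import Data.Sum.Base using ([_,_]′)
open import Function.Base using (_∘_)
open import Relation.Binary.PropositionalEquality
open import Relation.Nullary using (¬_; yes; no)

open ≡-Reasoning

-- Finite sums

∑ : ℕ → (ℕ → ℕ) → ℕ
∑ n f = sum (applyUpTo f n)

∑-cong : ∀ n {f g : ℕ → ℕ} → (∀ k → k < n → f k ≡ g k) → ∑ n f ≡ ∑ n g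
∑-cong zero    eq = refl
∑-cong (suc n) eq = cong₂ _+_ (eq 0 z<s) (∑-cong n (λ k k<n → eq (suc k) (s<s k<n)))

∑-+ : ∀ n (f g : ℕ → ℕ) → ∑ n (λ k → f k + g k) ≡ ∑ n f + ∑ n g
∑-+ zero    f g = refl
∑-+ (suc n) f g = trans (cong (f 0 + g 0 +_) (∑-+ n (f ∘ suc) (g ∘ suc)))
                        (interchange (f 0) (g 0) _ _)
  where
  interchange : ∀ a b c d → a + b + (c + d) ≡ a + c + (b + d)
  interchange = solve-∀

∑-*ˡ : ∀ n c (f : ℕ → ℕ) → ∑ n (λ k → c * f k) ≡ c * ∑ n f
∑-*ˡ zero    c f = sym (*-zeroʳ c)
∑-*ˡ (suc n) c f = trans (cong (c * f 0 +_) (∑-*ˡ n c (f ∘ suc)))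
                         (sym (*-distribˡ-+ c (f 0) _))

∑-last : ∀ n (f : ℕ → ℕ) → ∑ (suc n) f ≡ ∑ n f + f n
∑-last zero    f = +-identityʳ (f 0)
∑-last (suc n) f = trans (cong (f 0 +_) (∑-last n (f ∘ suc)))
                         (sym (+-assoc (f 0) _ _))

∑-zero : ∀ n {f : ℕ → ℕ} → (∀ k → k < n → f k ≡ 0) → ∑ n f ≡ 0
∑-zero zero    eq = refl
∑-zero (suc n) eq = cong₂ _+_ (eq 0 z<s) (∑-zero n (λ k k<n → eq (suc k) (s<s k<n)))

-- Lets the sum in `A`, which starts at `l`, be replaced by one from 0: the factor `k C l` vanishes
-- for `k < l`. All `S l m` with the same `m` then share one range and can be combined termwise.
∑-drop : ∀ l n (f : ℕ → ℕ) → (∀ k → k < l → f k ≡ 0) → ∑ (n ∸ l) (λ i → f (l + i)) ≡ ∑ n f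
∑-drop zero    n       f eq = refl
∑-drop (suc l) zero    f eq = refl
∑-drop (suc l) (suc n) f eq = begin
  ∑ (n ∸ l) (λ i → f (suc (l + i))) ≡⟨ ∑-drop l n (f ∘ suc) (λ k k<l → eq (suc k) (s<s k<l)) ⟩
  ∑ n (f ∘ suc)                     ≡⟨ cong (_+ ∑ n (f ∘ suc)) (eq 0 z<s) ⟨
  f 0 + ∑ n (f ∘ suc)               ∎

-- Binomial coefficients

-- Subtraction-free form of (k+1) C(n,k+1) = (n-k) C(n,k), proved by induction with Pascal's rule.
-- Truncated subtraction is avoided, so `k > n` needs no separate treatment.
[k+1]*nC[k+1]+k*nCk≡n*nCk : ∀ n k → suc k * (n C suc k) + k * (n C k) ≡ n * (n C k)
[k+1]*nC[k+1]+k*nCk≡n*nCk zero    zero    = refl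
[k+1]*nC[k+1]+k*nCk≡n*nCk zero    (suc k) = cong₂ _+_ (*-zeroʳ k) (*-zeroʳ k)
[k+1]*nC[k+1]+k*nCk≡n*nCk (suc n) zero    = begin
  1 * (suc n C 1) + 0 ≡⟨ cong (λ x → 1 * x + 0) (nC1≡n (suc n)) ⟩
  1 * suc n + 0       ≡⟨ eq n ⟩
  suc n * 1           ∎
  where
  eq : ∀ n → 1 * (1 + n) + 0 ≡ (1 + n) * 1
  eq = solve-∀
[k+1]*nC[k+1]+k*nCk≡n*nCk (suc n) (suc k) = begin
  (2 + k) * (suc n C (2 + k)) + suc k * (suc n C suc k)
    ≡⟨ cong₂ (λ x y → (2 + k) * x + suc k * y)
         (nCk+nC[k+1]≡[n+1]C[k+1] n (suc k)) (nCk+nC[k+1]≡[n+1]C[k+1] n k) ⟨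
  (2 + k) * (c₁ + c₂) + suc k * (c₀ + c₁)
    ≡⟨ regroup k c₀ c₁ c₂ ⟩
  ((2 + k) * c₂ + suc k * c₁) + (suc k * c₁ + k * c₀) + (c₀ + c₁)
    ≡⟨ cong₂ (λ x y → x + y + (c₀ + c₁))
         ([k+1]*nC[k+1]+k*nCk≡n*nCk n (suc k)) ([k+1]*nC[k+1]+k*nCk≡n*nCk n k) ⟩
  n * c₁ + n * c₀ + (c₀ + c₁)
    ≡⟨ collect n c₀ c₁ ⟩
  suc n * (c₀ + c₁)
    ≡⟨ cong (suc n *_) (nCk+nC[k+1]≡[n+1]C[k+1] n k) ⟩
  suc n * (suc n C suc k) ∎
  where
  c₀ = n C k
  c₁ = n C suc k
  c₂ = n C (2 + k)
  regroup : ∀ k a b c → (2 + k) * (b + c) + (1 + k) * (a + b)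
                      ≡ ((2 + k) * c + (1 + k) * b) + ((1 + k) * b + k * a) + (a + b)
  regroup = solve-∀
  collect : ∀ n a b → n * b + n * a + (a + b) ≡ (1 + n) * (a + b)
  collect = solve-∀

[k+1]*[n+1]C[k+1]≡[n+1]*nCk : ∀ n k → suc k * (suc n C suc k) ≡ suc n * (n C k)
[k+1]*[n+1]C[k+1]≡[n+1]*nCk n k = begin
  suc k * (suc n C suc k)                       ≡⟨ cong (suc k *_) (nCk+nC[k+1]≡[n+1]C[k+1] n k) ⟨
  suc k * (n C k + n C suc k)                   ≡⟨ regroup k (n C k) (n C suc k) ⟩
  n C k + (suc k * (n C suc k) + k * (n C k))   ≡⟨ cong (n C k +_) ([k+1]*nC[k+1]+k*nCk≡n*nCk n k) ⟩
  suc n * (n C k)                               ∎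
  where
  regroup : ∀ k a b → (1 + k) * (a + b) ≡ a + ((1 + k) * b + k * a)
  regroup = solve-∀

[k+1]*nC[k+1]≡[n∸k]*nCk : ∀ k e → suc k * ((k + e) C suc k) ≡ e * ((k + e) C k)
[k+1]*nC[k+1]≡[n∸k]*nCk k e = +-cancelʳ-≡ (k * c) _ _
  (trans ([k+1]*nC[k+1]+k*nCk≡n*nCk (k + e) k) (swap k e c))
  where
  c = (k + e) C k
  swap : ∀ k e c → (k + e) * c ≡ e * c + k * c
  swap = solve-∀

-- Absorption is applied twice, from row 2d+2 to 2d+1 and from there to 2d. In between, the two
-- equal middle entries of row 2d+1 are exchanged, by `[k+1]*nC[k+1]≡[n∸k]*nCk` with `e = suc d`.
centralBinomial-suc : ∀ d → suc d * ((2 * suc d) C suc d) ≡ 2 * ((1 + 2 * d) * ((2 * d) C d))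
centralBinomial-suc d = begin
  suc d * ((2 * suc d) C suc d)        ≡⟨ cong (λ x → suc d * (x C suc d)) (double d) ⟩
  suc d * ((2 + 2 * d) C suc d)        ≡⟨ [k+1]*[n+1]C[k+1]≡[n+1]*nCk (1 + 2 * d) d ⟩
  (2 + 2 * d) * ((1 + 2 * d) C d)      ≡⟨ factor d ((1 + 2 * d) C d) ⟩
  2 * (suc d * ((1 + 2 * d) C d))      ≡⟨ cong (λ n → 2 * (suc d * (n C d))) (half d) ⟨
  2 * (suc d * ((d + suc d) C d))      ≡⟨ cong (2 *_) ([k+1]*nC[k+1]≡[n∸k]*nCk d (suc d)) ⟨
  2 * (suc d * ((d + suc d) C suc d))  ≡⟨ cong (λ n → 2 * (suc d * (n C suc d))) (half d) ⟩
  2 * (suc d * ((1 + 2 * d) C suc d))  ≡⟨ cong (2 *_) ([k+1]*[n+1]C[k+1]≡[n+1]*nCk (2 * d) d) ⟩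
  2 * ((1 + 2 * d) * ((2 * d) C d))    ∎
  where
  double : ∀ d → 2 * (1 + d) ≡ 2 + 2 * d
  double = solve-∀
  half : ∀ d → d + (1 + d) ≡ 1 + 2 * d
  half = solve-∀
  factor : ∀ d c → (2 + 2 * d) * c ≡ 2 * ((1 + d) * c)
  factor = solve-∀

k!*j!*[k+j]Ck≡[k+j]! : ∀ k j → k ! * j ! * ((k + j) C k) ≡ (k + j) !
k!*j!*[k+j]Ck≡[k+j]! k j = begin
  k ! * j ! * ((k + j) C k)
    ≡⟨ *-comm (k ! * j !) _ ⟩
  ((k + j) C k) * (k ! * j !)
    ≡⟨ cong (λ x → ((k + j) C k) * (k ! * x !)) (m+n∸m≡n k j) ⟨
  ((k + j) C k) * (k ! * (k + j ∸ k) !)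
    ≡⟨ cong (_* (k ! * (k + j ∸ k) !)) (nCk≡n!/k![n-k]! (m≤m+n k j)) ⟩
  ((k + j) ! / (k ! * (k + j ∸ k) !)) * (k ! * (k + j ∸ k) !)
    ≡⟨ m/n*n≡m (k![n∸k]!∣n! (m≤m+n k j)) ⟩
  (k + j) ! ∎
  where instance _ = k !* (k + j ∸ k) !≢0

-- The ratio of adjacent binomials applied twice, with `n = k + e`. At `e = 0` the default
-- `pred 0 = 0` is harmless because of the factor `e`.
[k+1]*[k+2]*nC[k+2]≡[n∸k∸1]*[n∸k]*nCk : ∀ k e →
  suc k * ((2 + k) * ((k + e) C (2 + k))) ≡ pred e * (e * ((k + e) C k))
[k+1]*[k+2]*nC[k+2]≡[n∸k∸1]*[n∸k]*nCk k zero
  rewrite +-identityʳ k | k>n⇒nCk≡0 (m<n⇒m<1+n (n<1+n k)) | *-zeroʳ k = *-zeroʳ k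
[k+1]*[k+2]*nC[k+2]≡[n∸k∸1]*[n∸k]*nCk k (suc e) = begin
  suc k * ((2 + k) * ((k + suc e) C (2 + k)))  ≡⟨ cong (λ x → suc k * ((2 + k) * (x C (2 + k)))) (+-suc k e) ⟩
  suc k * ((2 + k) * ((suc k + e) C (2 + k)))  ≡⟨ cong (suc k *_) ([k+1]*nC[k+1]≡[n∸k]*nCk (suc k) e) ⟩
  suc k * (e * ((suc k + e) C suc k))          ≡⟨ swap (suc k) e _ ⟩
  e * (suc k * ((suc k + e) C suc k))          ≡⟨ cong (λ x → e * (suc k * (x C suc k))) (+-suc k e) ⟨
  e * (suc k * ((k + suc e) C suc k))          ≡⟨ cong (e *_) ([k+1]*nC[k+1]≡[n∸k]*nCk k (suc e)) ⟩
  e * (suc e * ((k + suc e) C k))              ∎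
  where
  swap : ∀ a b c → a * (b * c) ≡ b * (a * c)
  swap = solve-∀

-- The three-term recurrence in l

-- The part of the summand free of `l`, kept in the exact shape used in `A`, so that `A` unfolds to
-- it.
coeff : ℕ → ℕ → ℕ
coeff m k = 2 ^ k * ((2 * m ∸ 2 * k) C (m ∸ k)) * ((m + k) C k)

coeff-+ : ∀ k d → coeff (k + d) k ≡ 2 ^ k * ((2 * d) C d) * ((k + d + k) C k)
coeff-+ k d = cong₂ (λ x y → 2 ^ k * (x C y) * ((k + d + k) C k))
  (trans (cong (_∸ 2 * k) (*-distribˡ-+ 2 k d)) (m+n∸m≡n (2 * k) (2 * d)))
  (m+n∸m≡n k d)

-- The ratio c_{k+1} / c_k with denominators cleared and `d` for m-k-1. The 2 gained from 2^(k+1)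
-- cancels the 2 in `centralBinomial-suc`.
coeff-suc : ∀ k d → let m = suc k + d in
  suc k * (1 + 2 * d) * coeff m (suc k) ≡ suc d * (1 + m + k) * coeff m k
coeff-suc k d = begin
  suc k * (1 + 2 * d) * coeff m (suc k)
    ≡⟨ cong (suc k * (1 + 2 * d) *_) (coeff-+ (suc k) d) ⟩
  suc k * (1 + 2 * d) * (2 * 2 ^ k * ((2 * d) C d) * ((m + suc k) C suc k))
    ≡⟨ left k d (2 ^ k) ((2 * d) C d) ((m + suc k) C suc k) ⟩
  2 ^ k * (2 * ((1 + 2 * d) * ((2 * d) C d))) * (suc k * ((m + suc k) C suc k))
    ≡⟨ cong₂ (λ x y → 2 ^ k * x * y) (sym (centralBinomial-suc d)) absorb ⟩
  2 ^ k * (suc d * ((2 * suc d) C suc d)) * ((1 + m + k) * ((m + k) C k))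
    ≡⟨ right d (1 + m + k) (2 ^ k) ((2 * suc d) C suc d) ((m + k) C k) ⟩
  suc d * (1 + m + k) * (2 ^ k * ((2 * suc d) C suc d) * ((m + k) C k))
    ≡⟨ cong (λ x → suc d * (1 + m + k) * (2 ^ k * ((2 * suc d) C suc d) * ((x + k) C k))) (+-suc k d) ⟨
  suc d * (1 + m + k) * (2 ^ k * ((2 * suc d) C suc d) * ((k + suc d + k) C k))
    ≡⟨ cong (suc d * (1 + m + k) *_) (coeff-+ k (suc d)) ⟨
  suc d * (1 + m + k) * coeff (k + suc d) k
    ≡⟨ cong (λ x → suc d * (1 + m + k) * coeff x k) (+-suc k d) ⟩
  suc d * (1 + m + k) * coeff m k ∎
  where
  m = suc k + d
  absorb : suc k * ((m + suc k) C suc k) ≡ (1 + m + k) * ((m + k) C k)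
  absorb = trans (cong (λ x → suc k * (x C suc k)) (+-suc m k))
                 ([k+1]*[n+1]C[k+1]≡[n+1]*nCk (m + k) k)
  left : ∀ k d p x y → (1 + k) * (1 + 2 * d) * (2 * p * x * y)
                     ≡ p * (2 * ((1 + 2 * d) * x)) * ((1 + k) * y)
  left = solve-∀
  right : ∀ d a p x y → p * ((1 + d) * x) * (a * y) ≡ (1 + d) * a * (p * x * y)
  right = solve-∀

S : ℕ → ℕ → ℕ
S l m = ∑ (suc m) (λ k → coeff m k * (k C l))

-- Replaces c_k (m - k)(m + k + 1) by its multiple of c_{k+1} and shifts the index.
∑-shift : ∀ l m →
  ∑ (suc m) (λ k → coeff m k * ((m ∸ k) * (1 + m + k) * (k C l))) ≡
  ∑ (suc m) (λ k → coeff m k * ((1 + 2 * (m ∸ k)) * (suc l * (k C suc l))))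
∑-shift l m = begin
  ∑ (suc m) f     ≡⟨ ∑-last m f ⟩
  ∑ m f + f m     ≡⟨ cong (∑ m f +_) f-last ⟩
  ∑ m f + 0       ≡⟨ +-identityʳ _ ⟩
  ∑ m f           ≡⟨ ∑-cong m step ⟩
  ∑ m (g ∘ suc)   ≡⟨ cong (_+ ∑ m (g ∘ suc)) g-first ⟨
  ∑ (suc m) g     ∎
  where
  f g : ℕ → ℕ
  f k = coeff m k * ((m ∸ k) * (1 + m + k) * (k C l))
  g k = coeff m k * ((1 + 2 * (m ∸ k)) * (suc l * (k C suc l)))

  -- Both boundary terms vanish, through `m ∸ m` and `0 C suc l`, so the shift loses nothing.
  f-last : f m ≡ 0
  f-last = trans (cong (λ x → coeff m m * (x * (1 + m + m) * (m C l))) (n∸n≡0 m))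
                 (*-zeroʳ (coeff m m))

  g-first : g 0 ≡ 0
  g-first = vanish (coeff m 0) (1 + 2 * m) (suc l)
    where
    vanish : ∀ a b c → a * (b * (c * 0)) ≡ 0
    vanish = solve-∀

  step : ∀ k → k < m → f k ≡ g (suc k)
  step k k<m with m≤n⇒∃[o]m+o≡n k<m
  ... | d , refl = begin
    coeff m k * ((m ∸ k) * (1 + m + k) * (k C l))
      ≡⟨ cong (λ x → coeff m k * (x * (1 + m + k) * (k C l)))
           (trans (cong (_∸ k) (sym (+-suc k d))) (m+n∸m≡n k (suc d))) ⟩
    coeff m k * (suc d * (1 + m + k) * (k C l))
      ≡⟨ rotate (coeff m k) (suc d * (1 + m + k)) (k C l) ⟩
    suc d * (1 + m + k) * coeff m k * (k C l)
      ≡⟨ cong (_* (k C l)) (coeff-suc k d) ⟨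
    suc k * (1 + 2 * d) * coeff m (suc k) * (k C l)
      ≡⟨ regroup (suc k) (1 + 2 * d) (coeff m (suc k)) (k C l) ⟩
    coeff m (suc k) * ((1 + 2 * d) * (suc k * (k C l)))
      -- The factor `suc k` left by the ratio is absorbed into `k C l`, raising both of its indices.
      ≡⟨ cong₂ (λ x y → coeff m (suc k) * ((1 + 2 * x) * y))
           (m+n∸m≡n (suc k) d) ([k+1]*[n+1]C[k+1]≡[n+1]*nCk k l) ⟨
    coeff m (suc k) * ((1 + 2 * (m ∸ suc k)) * (suc l * (suc k C suc l))) ∎
    where
    rotate : ∀ a b c → a * (b * c) ≡ b * a * c
    rotate = solve-∀
    regroup : ∀ a b c d → a * b * c * d ≡ c * (b * (a * d))
    regroup = solve-∀

-- The recurrence before summation. For `k < l` all binomials vanish; for k = l+e and m = k+d each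
-- is a multiple of `k C l`, and a polynomial identity in `l`, `d`, `e` remains.
binomial-identity : ∀ l n k → k ≤ l + n → let m = l + n in
  n * (1 + m + l) * (k C l) + suc l * ((2 + l) * (k C (2 + l)))
    + (1 + 2 * (m ∸ k)) * (suc l * (k C suc l))
  ≡ (1 + 2 * m) * (suc l * (k C suc l)) + (m ∸ k) * (1 + m + k) * (k C l)
binomial-identity l n k k≤m with k <? l
... | yes k<l rewrite k>n⇒nCk≡0 k<l | k>n⇒nCk≡0 (m<n⇒m<1+n k<l) | k>n⇒nCk≡0 (m<n⇒m<1+n (m<n⇒m<1+n k<l))
  = vanish (n * (1 + (l + n) + l)) (1 + 2 * (l + n ∸ k)) (1 + 2 * (l + n)) ((l + n ∸ k) * (1 + (l + n) + k)) l
  where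
  vanish : ∀ a b c d l → a * 0 + (1 + l) * ((2 + l) * 0) + b * ((1 + l) * 0) ≡ c * ((1 + l) * 0) + d * 0
  vanish = solve-∀
... | no k≮l with m≤n⇒∃[o]m+o≡n (≮⇒≥ k≮l)
... | e , refl with m≤n⇒∃[o]m+o≡n (+-cancelˡ-≤ l e n k≤m)
... | d , refl
  rewrite trans (cong (_∸ (l + e)) (sym (+-assoc l e d))) (m+n∸m≡n (l + e) d)
        | [k+1]*[k+2]*nC[k+2]≡[n∸k∸1]*[n∸k]*nCk l e
        | [k+1]*nC[k+1]≡[n∸k]*nCk l e
  = polynomial e ((l + e) C l)
  where
  -- Splitting on `e` makes `pred e` compute, so that the ring solver applies.
  polynomial : ∀ e c → (e + d) * (1 + (l + (e + d)) + l) * c + pred e * (e * c) + (1 + 2 * d) * (e * c)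
                     ≡ (1 + 2 * (l + (e + d))) * (e * c) + d * (1 + (l + (e + d)) + (l + e)) * c
  polynomial zero c = p₀ l d c
    where
    p₀ : ∀ l d c → (0 + d) * (1 + (l + (0 + d)) + l) * c + 0 + (1 + 2 * d) * 0
                 ≡ (1 + 2 * (l + (0 + d))) * 0 + d * (1 + (l + (0 + d)) + (l + 0)) * c
    p₀ = solve-∀
  polynomial (suc e) c = p₊ l d e c
    where
    p₊ : ∀ l d e c → (1 + e + d) * (1 + (l + (1 + e + d)) + l) * c + e * ((1 + e) * c) + (1 + 2 * d) * ((1 + e) * c)
                   ≡ (1 + 2 * (l + (1 + e + d))) * ((1 + e) * c) + d * (1 + (l + (1 + e + d)) + (l + (1 + e))) * c
    p₊ = solve-∀

-- Sums `binomial-identity` with weights `coeff m k`. The sum of `y` is added on the left; on the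
-- right `∑-shift` turns the sum of `x` into the same quantity, which then cancels.
S-recurrence : ∀ l n → let m = l + n in
  n * (1 + m + l) * S l m + suc l * ((2 + l) * S (2 + l) m) ≡ (1 + 2 * m) * (suc l * S (1 + l) m)
S-recurrence l n = +-cancelʳ-≡ (∑ (suc m) y) _ _ (begin
  a * S l m + suc l * ((2 + l) * S (2 + l) m) + ∑ (suc m) y
    ≡⟨ cong (λ x → a * S l m + x + ∑ (suc m) y) (*-assoc (suc l) (2 + l) (S (2 + l) m)) ⟨
  a * S l m + b * S (2 + l) m + ∑ (suc m) y
    ≡⟨ cong (_+ ∑ (suc m) y) (cong₂ _+_ (∑-*ˡ (suc m) a (term l)) (∑-*ˡ (suc m) b (term (2 + l)))) ⟨
  ∑ (suc m) u + ∑ (suc m) v + ∑ (suc m) y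
    ≡⟨ cong (_+ ∑ (suc m) y) (∑-+ (suc m) u v) ⟨
  ∑ (suc m) (λ k → u k + v k) + ∑ (suc m) y
    ≡⟨ ∑-+ (suc m) (λ k → u k + v k) y ⟨
  ∑ (suc m) (λ k → u k + v k + y k)
    ≡⟨ ∑-cong (suc m) (λ k k<1+m → termwise k (s≤s⁻¹ k<1+m)) ⟩
  ∑ (suc m) (λ k → w k + x k)
    ≡⟨ ∑-+ (suc m) w x ⟩
  ∑ (suc m) w + ∑ (suc m) x
    ≡⟨ cong₂ _+_ (∑-*ˡ (suc m) c (term (1 + l))) (∑-shift l m) ⟩
  c * S (1 + l) m + ∑ (suc m) y
    ≡⟨ cong (_+ ∑ (suc m) y) (*-assoc (1 + 2 * m) (suc l) (S (1 + l) m)) ⟩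
  (1 + 2 * m) * (suc l * S (1 + l) m) + ∑ (suc m) y ∎)
  where
  m = l + n
  a = n * (1 + m + l)
  b = suc l * (2 + l)
  c = (1 + 2 * m) * suc l
  term : ℕ → ℕ → ℕ
  term i k = coeff m k * (k C i)
  u v w x y : ℕ → ℕ
  u k = a * term l k
  v k = b * term (2 + l) k
  w k = c * term (1 + l) k
  x k = coeff m k * ((m ∸ k) * (1 + m + k) * (k C l))
  y k = coeff m k * ((1 + 2 * (m ∸ k)) * (suc l * (k C suc l)))

  termwise : ∀ k → k ≤ m → u k + v k + y k ≡ w k + x k
  termwise k k≤m = begin
    u k + v k + y k
      ≡⟨ left (coeff m k) a (suc l) (2 + l) (k C l) (k C (2 + l)) _ ⟩
    coeff m k * (a * (k C l) + suc l * ((2 + l) * (k C (2 + l))) + (1 + 2 * (m ∸ k)) * (suc l * (k C suc l)))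
      ≡⟨ cong (coeff m k *_) (binomial-identity l n k k≤m) ⟩
    coeff m k * ((1 + 2 * m) * (suc l * (k C suc l)) + (m ∸ k) * (1 + m + k) * (k C l))
      ≡⟨ right (coeff m k) (1 + 2 * m) (suc l) (k C suc l) _ ⟩
    w k + x k ∎
    where
    left : ∀ q a b₁ b₂ r s t → a * (q * r) + b₁ * b₂ * (q * s) + q * t ≡ q * (a * r + b₁ * (b₂ * s) + t)
    left = solve-∀
    right : ∀ q c₁ c₂ r t → q * (c₁ * (c₂ * r) + t) ≡ c₁ * c₂ * (q * r) + q * t
    right = solve-∀

F : ℕ → ℕ → ℕ
F l m = l ! * m ! * S l m

-- The factor `l !` takes up `suc l` and `2 + l`, which leaves `F (2 + l) m` with coefficient 1.
F-recurrence : ∀ l n → let m = l + n in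
  n * (1 + m + l) * F l m + F (2 + l) m ≡ (1 + 2 * m) * F (1 + l) m
F-recurrence l n = begin
  n * (1 + m + l) * F l m + F (2 + l) m
    ≡⟨ left (n * (1 + m + l)) l (l !) (m !) (S l m) (S (2 + l) m) ⟩
  l ! * m ! * (n * (1 + m + l) * S l m + suc l * ((2 + l) * S (2 + l) m))
    ≡⟨ cong (l ! * m ! *_) (S-recurrence l n) ⟩
  l ! * m ! * ((1 + 2 * m) * (suc l * S (1 + l) m))
    ≡⟨ right (1 + 2 * m) l (l !) (m !) (S (1 + l) m) ⟩
  (1 + 2 * m) * F (1 + l) m ∎
  where
  m = l + n
  left : ∀ a l p q r s → a * (p * q * r) + (2 + l) * ((1 + l) * p) * q * s
                       ≡ p * q * (a * r + (1 + l) * ((2 + l) * s))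
  left = solve-∀
  right : ∀ a l p q r → p * q * (a * ((1 + l) * r)) ≡ a * ((1 + l) * p * q * r)
  right = solve-∀

-- Start of the downward induction, equivalent to b_m = 1: only the term `k = m` survives.
F-diagonal : ∀ m → F m m ≡ 2 ^ m * (m + m) !
F-diagonal m = begin
  m ! * m ! * S m m                            ≡⟨ cong (m ! * m ! *_) S-diagonal ⟩
  m ! * m ! * (2 ^ m * ((m + m) C m))          ≡⟨ swap (m ! * m !) (2 ^ m) _ ⟩
  2 ^ m * (m ! * m ! * ((m + m) C m))          ≡⟨ cong (2 ^ m *_) (k!*j!*[k+j]Ck≡[k+j]! m m) ⟩
  2 ^ m * (m + m) !                            ∎
  where
  swap : ∀ a b c → a * (b * c) ≡ b * (a * c)
  swap = solve-∀
  S-diagonal : S m m ≡ 2 ^ m * ((m + m) C m)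
  S-diagonal = begin
    S m m
      ≡⟨ ∑-last m _ ⟩
    ∑ m (λ k → coeff m k * (k C m)) + coeff m m * (m C m)
      ≡⟨ cong₂ _+_ (∑-zero m (λ k k<m → trans (cong (coeff m k *_) (k>n⇒nCk≡0 k<m)) (*-zeroʳ (coeff m k))))
                   (trans (cong (coeff m m *_) (nCn≡1 m)) (*-identityʳ _)) ⟩
    coeff m m
      ≡⟨ cong₂ (λ x y → 2 ^ m * (x C y) * ((m + m) C m)) (n∸n≡0 (2 * m)) (n∸n≡0 m) ⟩
    2 ^ m * 1 * ((m + m) C m)
      ≡⟨ cong (_* ((m + m) C m)) (*-identityʳ (2 ^ m)) ⟩
    2 ^ m * ((m + m) C m) ∎

-- The odd part

2∣n*[n+1] : ∀ n → 2 ∣ n * suc n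
2∣n*[n+1] zero    = 2 ∣0
2∣n*[n+1] (suc n) = subst (2 ∣_) (eq n) (∣m∣n⇒∣m+n (2∣n*[n+1] n) (m∣m*n (suc n)))
  where
  eq : ∀ n → n * (1 + n) + 2 * (1 + n) ≡ (1 + n) * (2 + n)
  eq = solve-∀

-- eq₂ has n ! where (n ∸ 1) ! would be natural, so that n = 0 is covered, with e = 0;
-- otherwise e = n b_{l+2}.
odd-part-step : ∀ l n {b₁ e} → let m = l + suc n in
  F (1 + l) m * n ! ≡ 2 ^ m * (1 + l + m) ! * b₁ → ¬ (2 ∣ b₁) →
  F (2 + l) m * n ! ≡ 2 ^ m * (2 + l + m) ! * e → 2 ∣ (2 + l + m) * e →
  ∃[ b ] ¬ (2 ∣ b) × F l m * (1 + n) ! ≡ 2 ^ m * (l + m) ! * b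
odd-part-step l n {b₁} {e} eq₁ odd₁ eq₂ even =
  let divides b eq = p∣F in
  b , odd b eq , trans eq (*-comm b p)
  where
  m = l + suc n
  p = 2 ^ m * (l + m) !

  -- The recurrence times `n !`, with the common factor `suc (l + m)` split off the factorials so
  -- that it can be cancelled.
  scaled : suc (l + m) * (F l m * (1 + n) ! + p * ((2 + l + m) * e))
         ≡ suc (l + m) * ((1 + 2 * m) * b₁ * p)
  scaled = begin
    suc (l + m) * (F l m * (1 + n) ! + p * ((2 + l + m) * e))
      ≡⟨ expand l m n (F l m) (n !) (2 ^ m) ((l + m) !) e ⟩
    suc n * (1 + m + l) * F l m * n ! + 2 ^ m * (2 + l + m) ! * e
      ≡⟨ cong (suc n * (1 + m + l) * F l m * n ! +_) eq₂ ⟨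
    suc n * (1 + m + l) * F l m * n ! + F (2 + l) m * n !
      ≡⟨ *-distribʳ-+ (n !) (suc n * (1 + m + l) * F l m) _ ⟨
    (suc n * (1 + m + l) * F l m + F (2 + l) m) * n !
      ≡⟨ cong (_* n !) (F-recurrence l (suc n)) ⟩
    (1 + 2 * m) * F (1 + l) m * n !
      ≡⟨ *-assoc (1 + 2 * m) (F (1 + l) m) (n !) ⟩
    (1 + 2 * m) * (F (1 + l) m * n !)
      ≡⟨ cong ((1 + 2 * m) *_) eq₁ ⟩
    (1 + 2 * m) * (2 ^ m * (1 + l + m) ! * b₁)
      ≡⟨ collect (1 + 2 * m) (2 ^ m) (1 + l + m) ((l + m) !) b₁ ⟩
    suc (l + m) * ((1 + 2 * m) * b₁ * p) ∎
    where
    expand : ∀ l m n f g q h e →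
      (1 + (l + m)) * (f * ((1 + n) * g) + q * h * ((2 + l + m) * e)) ≡
      (1 + n) * (1 + m + l) * f * g + q * ((2 + (l + m)) * ((1 + (l + m)) * h)) * e
    expand = solve-∀
    collect : ∀ a q s h b → a * (q * (s * h) * b) ≡ s * (a * b * (q * h))
    collect = solve-∀

  reduced : F l m * (1 + n) ! + p * ((2 + l + m) * e) ≡ (1 + 2 * m) * b₁ * p
  reduced = *-cancelˡ-≡ _ _ (suc (l + m)) scaled

  -- Integrality of b_l: `p` divides the other two terms of `reduced`.
  p∣F : p ∣ F l m * (1 + n) !
  p∣F = ∣m+n∣m⇒∣n (subst (p ∣_) (trans (sym reduced) (+-comm (F l m * (1 + n) !) (p * ((2 + l + m) * e)))) (n∣m*n ((1 + 2 * m) * b₁)))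
                  (m∣m*n ((2 + l + m) * e))

  instance
    p≢0 : NonZero p
    p≢0 = m*n≢0 (2 ^ m) ((l + m) !) {{m^n≢0 2 m}} {{(l + m) !≢0}}

  -- Divided by `p`, `reduced` says that `b` plus an even number is (2m+1) `b₁`, so `b` and `b₁`
  -- have the same parity.
  odd : ∀ b → F l m * (1 + n) ! ≡ b * p → ¬ (2 ∣ b)
  odd b eq 2∣b = odd₁ (∣m+n∣m⇒∣n (subst (2 ∣_) split (∣m∣n⇒∣m+n 2∣b even)) (m∣m*n (m * b₁)))
    where
    split : b + (2 + l + m) * e ≡ 2 * (m * b₁) + b₁
    split = trans
      (*-cancelʳ-≡ _ _ p (begin
        (b + (2 + l + m) * e) * p       ≡⟨ *-distribʳ-+ p b _ ⟩
        b * p + (2 + l + m) * e * p     ≡⟨ cong₂ _+_ (sym eq) (*-comm _ p) ⟩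
        F l m * (1 + n) ! + p * ((2 + l + m) * e) ≡⟨ reduced ⟩
        (1 + 2 * m) * b₁ * p            ∎))
      (unfold m b₁)
      where
      unfold : ∀ m b → (1 + 2 * m) * b ≡ 2 * (m * b) + b
      unfold = solve-∀

-- Recursion on `n`, the distance from the diagonal. The equation is a hypothesis so that `m` stays
-- fixed while `l` moves to `1 + l` and `2 + l`.
odd-part : ∀ m n l → l + n ≡ m → ∃[ b ] ¬ (2 ∣ b) × F l m * n ! ≡ 2 ^ m * (l + m) ! * b
odd-part m zero l l+0≡m with trans (sym (+-identityʳ l)) l+0≡m
... | refl = 1 , (λ 2∣1 → <⇒≱ (n<1+n 1) (∣⇒≤ 2∣1)) , cong (_* 1) (F-diagonal l)
odd-part m (suc zero) l refl with odd-part m zero (suc l) (sym (+-suc l 0))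
... | b₁ , odd₁ , eq₁ = odd-part-step l 0 {b₁} {0} eq₁ odd₁ F-zero
                          (subst (2 ∣_) (sym (*-zeroʳ (2 + l + m))) (2 ∣0))
  where
  -- Here `2 + l` is `m + 1`, beyond every `k` in the sum, so the step is taken with `e = 0`.
  S-zero : S (2 + l) m ≡ 0
  S-zero = ∑-zero (suc m) λ k k<1+m →
    trans (cong (coeff m k *_) (k>n⇒nCk≡0 (subst (k <_) (cong suc (+-comm l 1)) k<1+m)))
          (*-zeroʳ (coeff m k))
  F-zero : F (2 + l) m * 1 ≡ 2 ^ m * (2 + l + m) ! * 0
  F-zero = begin
    F (2 + l) m * 1               ≡⟨ cong (λ x → (2 + l) ! * m ! * x * 1) S-zero ⟩
    (2 + l) ! * m ! * 0 * 1       ≡⟨ cong (_* 1) (*-zeroʳ ((2 + l) ! * m !)) ⟩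
    0                             ≡⟨ *-zeroʳ (2 ^ m * (2 + l + m) !) ⟨
    2 ^ m * (2 + l + m) ! * 0     ∎
odd-part m (suc (suc n)) l refl
  with odd-part m (suc n) (1 + l) (sym (+-suc l (suc n)))
     | odd-part m n (2 + l) (sym (trans (+-suc l (suc n)) (cong suc (+-suc l n))))
... | b₁ , odd₁ , eq₁ | b₂ , _ , eq₂ = odd-part-step l (suc n) eq₁ odd₁ scaled even
  where
  scaled : F (2 + l) m * (suc n * n !) ≡ 2 ^ m * (2 + l + m) ! * (suc n * b₂)
  scaled = begin
    F (2 + l) m * (suc n * n !)               ≡⟨ swap (F (2 + l) m) (suc n) (n !) ⟩
    suc n * (F (2 + l) m * n !)               ≡⟨ cong (suc n *_) eq₂ ⟩
    suc n * (2 ^ m * (2 + l + m) ! * b₂)      ≡⟨ swap (suc n) (2 ^ m * (2 + l + m) !) b₂ ⟩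
    2 ^ m * (2 + l + m) ! * (suc n * b₂)      ∎
    where
    swap : ∀ a b c → a * (b * c) ≡ b * (a * c)
    swap = solve-∀
  -- As m = l+n+2, the product (2+l+m)(n+1) is (n+1)(n+2) + 2(l+1)(n+1), where (n+1)(n+2) is even.
  even : 2 ∣ (2 + l + m) * (suc n * b₂)
  even = subst (2 ∣_) (regroup l n b₂)
    (∣m⇒∣m*n b₂ (∣m∣n⇒∣m+n (2∣n*[n+1] (suc n)) (m∣m*n ((1 + l) * suc n))))
    where
    regroup : ∀ l n b → ((1 + n) * (2 + n) + 2 * ((1 + l) * (1 + n))) * b
                      ≡ (2 + l + (l + (2 + n))) * ((1 + n) * b)
    regroup = solve-∀

-- 2-adic valuations

^-monoʳ-∣ : ∀ a {i j} → i ≤ j → a ^ i ∣ a ^ j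
^-monoʳ-∣ a {i} i≤j with m≤n⇒∃[o]m+o≡n i≤j
... | k , refl = subst (a ^ i ∣_) (sym (^-distribˡ-+-* a i k)) (m∣m*n (a ^ k))

ν₂-unique : ∀ n k .{{_ : NonZero n}} → 2 ^ k ∣ n → ¬ (2 ^ suc k ∣ n) → ν₂ n ≡ k
ν₂-unique n k 2^k∣n 2^1+k∤n = ≤-antisym
  (≮⇒≥ λ k<ν → 2^1+k∤n (∣-trans (^-monoʳ-∣ 2 k<ν) (ν₂-divides n)))
  (≮⇒≥ λ ν<k → ν₂-maximal n (∣-trans (^-monoʳ-∣ 2 ν<k) 2^k∣n))

odd⇒nonZero : ∀ {b} → ¬ (2 ∣ b) → NonZero b
odd⇒nonZero {zero}  odd = ⊥-elim (odd (2 ∣0))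
odd⇒nonZero {suc _} _   = _

ν₂-2^k*odd : ∀ k b → ¬ (2 ∣ b) → ν₂ (2 ^ k * b) ≡ k
ν₂-2^k*odd k b odd = ν₂-unique (2 ^ k * b) k (m∣m*n b)
  λ 2^1+k∣ → odd (*-cancelˡ-∣ (2 ^ k) (subst (_∣ 2 ^ k * b) (*-comm 2 (2 ^ k)) 2^1+k∣))
  where
  instance
    _ : NonZero (2 ^ k)
    _ = m^n≢0 2 k
    _ : NonZero (2 ^ k * b)
    _ = m*n≢0 (2 ^ k) b {{m^n≢0 2 k}} {{odd⇒nonZero odd}}

oddPart : ∀ n .{{_ : NonZero n}} → ∃[ b ] ¬ (2 ∣ b) × n ≡ 2 ^ ν₂ n * b
oddPart n =
  let divides b n≡b*2^ν = ν₂-divides n in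
  b
  , (λ 2∣b → ν₂-maximal n (subst (2 ^ suc (ν₂ n) ∣_) (sym n≡b*2^ν) (*-monoˡ-∣ (2 ^ ν₂ n) 2∣b)))
  , trans n≡b*2^ν (*-comm b (2 ^ ν₂ n))

ν₂-* : ∀ m n .{{_ : NonZero m}} .{{_ : NonZero n}} → ν₂ (m * n) ≡ ν₂ m + ν₂ n
ν₂-* m n =
  let a , a-odd , m≡ = oddPart m
      b , b-odd , n≡ = oddPart n
  in begin
    ν₂ (m * n)                                 ≡⟨ cong₂ (λ x y → ν₂ (x * y)) m≡ n≡ ⟩
    ν₂ (2 ^ ν₂ m * a * (2 ^ ν₂ n * b))         ≡⟨ cong ν₂ (swap (2 ^ ν₂ m) a (2 ^ ν₂ n) b) ⟩
    ν₂ (2 ^ ν₂ m * 2 ^ ν₂ n * (a * b))         ≡⟨ cong (λ x → ν₂ (x * (a * b))) (^-distribˡ-+-* 2 (ν₂ m) (ν₂ n)) ⟨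
    ν₂ (2 ^ (ν₂ m + ν₂ n) * (a * b))           ≡⟨ ν₂-2^k*odd (ν₂ m + ν₂ n) (a * b) ([ a-odd , b-odd ]′ ∘ euclidsLemma a b prime[2]) ⟩
    ν₂ m + ν₂ n                                ∎
  where
  swap : ∀ p a q b → p * a * (q * b) ≡ p * q * (a * b)
  swap = solve-∀

ν₂-2^ : ∀ k → ν₂ (2 ^ k) ≡ k
ν₂-2^ k = trans (cong ν₂ (sym (*-identityʳ (2 ^ k)))) (ν₂-2^k*odd k 1 λ 2∣1 → <⇒≱ (n<1+n 1) (∣⇒≤ 2∣1))

ν₂-odd : ∀ b → ¬ (2 ∣ b) → ν₂ b ≡ 0
ν₂-odd b odd = trans (cong ν₂ (sym (*-identityˡ b))) (ν₂-2^k*odd 0 b odd)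

-- From 0 < i < 2^v follows `ν₂ i < v`, so the added multiple is divisible even by 2^(1 + `ν₂ i`)
-- and cannot change the valuation.
ν₂-+-multiple : ∀ v c i → 1 ≤ i → i < 2 ^ v → ν₂ (2 ^ v * c + i) ≡ ν₂ i
ν₂-+-multiple v c i@(suc _) _ i<2^v = ν₂-unique (2 ^ v * c + i) (ν₂ i)
  (∣m∣n⇒∣m+n (multiple (<⇒≤ ν<v)) (ν₂-divides i))
  (λ d → ν₂-maximal i (∣m+n∣m⇒∣n d (multiple ν<v)))
  where
  instance
    _ : NonZero (2 ^ v * c + i)
    _ = ≢-nonZero λ eq → 1+n≢0 (m+n≡0⇒n≡0 (2 ^ v * c) eq)
  ν<v : ν₂ i < v
  ν<v = ≰⇒> λ v≤ν → <⇒≱ i<2^v (∣⇒≤ (∣-trans (^-monoʳ-∣ 2 v≤ν) (ν₂-divides i)))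
  multiple : ∀ {k} → k ≤ v → 2 ^ k ∣ 2 ^ v * c
  multiple k≤v = ∣m⇒∣m*n c (^-monoʳ-∣ 2 k≤v)

-- The valuation of A

m+p≡o+n⇒m-n≡o-p : ∀ m n o p → m + p ≡ o + n → ℤ.+ m ℤ.- ℤ.+ n ≡ ℤ.+ o ℤ.- ℤ.+ p
m+p≡o+n⇒m-n≡o-p m n o p eq = begin
  ℤ.+ m ℤ.- ℤ.+ n                                      ≡⟨ left (ℤ.+ m) (ℤ.+ n) (ℤ.+ p) ⟩
  (ℤ.+ m ℤ.+ ℤ.+ p) ℤ.- (ℤ.+ n ℤ.+ ℤ.+ p)              ≡⟨ cong (λ x → ℤ.+ x ℤ.- (ℤ.+ n ℤ.+ ℤ.+ p)) eq ⟩
  (ℤ.+ o ℤ.+ ℤ.+ n) ℤ.- (ℤ.+ n ℤ.+ ℤ.+ p)              ≡⟨ right (ℤ.+ o) (ℤ.+ n) (ℤ.+ p) ⟩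
  ℤ.+ o ℤ.- ℤ.+ p                                      ∎
  where
  left : ∀ m n p → m ℤ.- n ≡ (m ℤ.+ p) ℤ.- (n ℤ.+ p)
  left = ℤSolver.solve-∀
  right : ∀ o n p → (o ℤ.+ n) ℤ.- (n ℤ.+ p) ≡ o ℤ.- p
  right = ℤSolver.solve-∀

m-n≡o-p⇒m+p≡o+n : ∀ m n o p → ℤ.+ m ℤ.- ℤ.+ n ≡ ℤ.+ o ℤ.- ℤ.+ p → m + p ≡ o + n
m-n≡o-p⇒m+p≡o+n m n o p eq = ℤ.+-injective (begin
  ℤ.+ m ℤ.+ ℤ.+ p                                ≡⟨ left (ℤ.+ m) (ℤ.+ n) (ℤ.+ p) ⟩
  (ℤ.+ m ℤ.- ℤ.+ n) ℤ.+ (ℤ.+ n ℤ.+ ℤ.+ p)        ≡⟨ cong (ℤ._+ (ℤ.+ n ℤ.+ ℤ.+ p)) eq ⟩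
  (ℤ.+ o ℤ.- ℤ.+ p) ℤ.+ (ℤ.+ n ℤ.+ ℤ.+ p)        ≡⟨ right (ℤ.+ o) (ℤ.+ n) (ℤ.+ p) ⟩
  ℤ.+ o ℤ.+ ℤ.+ n                                ∎)
  where
  left : ∀ m n p → m ℤ.+ p ≡ (m ℤ.- n) ℤ.+ (n ℤ.+ p)
  left = ℤSolver.solve-∀
  right : ∀ o n p → (o ℤ.- p) ℤ.+ (n ℤ.+ p) ≡ o ℤ.+ n
  right = ℤSolver.solve-∀

-- Rationals are stored in lowest terms, so numerator and denominator of the product are accessible
-- only through this cross-multiplied equation.
/*/-cross : ∀ p d s .{{_ : NonZero d}} → let q = (ℤ.+ p ℚ./ d) ℚ.* (ℤ.+ s ℚ./ 1) in
  ℤ.∣ ↥ q ∣ * d ≡ p * s * ↧ₙ q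
/*/-cross p d@(suc d-1) s = cross q q≃
  where
  q = (ℤ.+ p ℚ./ d) ℚ.* (ℤ.+ s ℚ./ 1)
  q≃ : toℚᵘ q ℚᵘ.≃ mkℚᵘ (ℤ.+ p) d-1 ℚᵘ.* mkℚᵘ (ℤ.+ s) 0
  q≃ = ℚᵘ.≃-trans (ℚ.toℚᵘ-homo-* (ℤ.+ p ℚ./ d) (ℤ.+ s ℚ./ 1))
    (ℚᵘ.*-cong (ℚ.toℚᵘ-fromℚᵘ (mkℚᵘ (ℤ.+ p) d-1)) (ℚ.toℚᵘ-fromℚᵘ (mkℚᵘ (ℤ.+ s) 0)))
  -- Stated for an arbitrary `q`, so that matching on `mkℚ` does not meet the normalised product.
  cross : ∀ q → toℚᵘ q ℚᵘ.≃ mkℚᵘ (ℤ.+ p) d-1 ℚᵘ.* mkℚᵘ (ℤ.+ s) 0 → ℤ.∣ ↥ q ∣ * d ≡ p * s * ↧ₙ q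
  cross (mkℚ n e-1 _) (*≡* eq) = begin
    ℤ.∣ n ∣ * d                          ≡⟨ cong (ℤ.∣ n ∣ *_) (*-identityʳ d) ⟨
    ℤ.∣ n ∣ * (d * 1)                    ≡⟨ ℤ.abs-* n (ℤ.+ (d * 1)) ⟨
    ℤ.∣ n ℤ.* ℤ.+ (d * 1) ∣              ≡⟨ cong ℤ.∣_∣ eq ⟩
    ℤ.∣ ℤ.+ p ℤ.* ℤ.+ s ℤ.* ℤ.+ suc e-1 ∣ ≡⟨ ℤ.abs-* (ℤ.+ p ℤ.* ℤ.+ s) (ℤ.+ suc e-1) ⟩
    ℤ.∣ ℤ.+ p ℤ.* ℤ.+ s ∣ * suc e-1      ≡⟨ cong (_* suc e-1) (ℤ.abs-* (ℤ.+ p) (ℤ.+ s)) ⟩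
    p * s * suc e-1                      ∎

-- By multiplicativity, the valuation can be read off any fraction representing `q`, reduced or not.
ν₂ℚ-ratio : ∀ q n d .{{_ : NonZero n}} .{{_ : NonZero d}} →
  ℤ.∣ ↥ q ∣ * d ≡ n * ↧ₙ q → ν₂ℚ q ≡ ℤ.+ ν₂ n ℤ.- ℤ.+ ν₂ d
ν₂ℚ-ratio q n d eq = m+p≡o+n⇒m-n≡o-p (ν₂ ℤ.∣ ↥ q ∣) (ν₂ (↧ₙ q)) (ν₂ n) (ν₂ d) (begin
  ν₂ ℤ.∣ ↥ q ∣ + ν₂ d   ≡⟨ ν₂-* ℤ.∣ ↥ q ∣ d ⟨
  ν₂ (ℤ.∣ ↥ q ∣ * d)    ≡⟨ cong ν₂ eq ⟩
  ν₂ (n * ↧ₙ q)         ≡⟨ ν₂-* n (↧ₙ q) ⟩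
  ν₂ n + ν₂ (↧ₙ q)      ∎)
  where
  instance
    _ : NonZero ℤ.∣ ↥ q ∣
    _ = m*n≢0⇒m≢0 ℤ.∣ ↥ q ∣ {d} {{subst NonZero (sym eq) (m*n≢0 n (↧ₙ q))}}

A-cross : ∀ l n → let m = l + n in ℤ.∣ ↥ A l m ∣ * 2 ^ n ≡ F l m * ↧ₙ (A l m)
A-cross l n = begin
  ℤ.∣ ↥ A l m ∣ * 2 ^ n          ≡⟨ cong (λ x → ℤ.∣ ↥ A l m ∣ * 2 ^ x) (m+n∸m≡n l n) ⟨
  ℤ.∣ ↥ A l m ∣ * 2 ^ (m ∸ l)    ≡⟨ /*/-cross (l ! * m !) (2 ^ (m ∸ l)) s {{m^n≢0 2 (m ∸ l)}} ⟩
  l ! * m ! * s * ↧ₙ (A l m)     ≡⟨ cong (λ x → l ! * m ! * x * ↧ₙ (A l m)) s≡S ⟩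
  F l m * ↧ₙ (A l m)             ∎
  where
  m = l + n
  s = sumFromTo l m (λ k → coeff m k * (k C l))
  s≡S : s ≡ S l m
  s≡S = ∑-drop l (suc m) _ λ k k<l →
    trans (cong (coeff m k *_) (k>n⇒nCk≡0 k<l)) (*-zeroʳ (coeff m k))

-- Read off from `odd-part`, whose right-hand side is a product of nonzero factors.
F≢0 : ∀ l n → NonZero (F l (l + n))
F≢0 l n =
  let m = l + n
      b , odd , eq = odd-part m n l refl
  in m*n≢0⇒m≢0 (F l m) {n !} {{subst NonZero (sym eq)
       (m*n≢0 (2 ^ m * (l + m) !) b
         {{m*n≢0 (2 ^ m) ((l + m) !) {{m^n≢0 2 m}} {{(l + m) !≢0}}}} {{odd⇒nonZero odd}})}}

ν₂-F : ∀ l n → let m = l + n in ν₂ (F l m) + ν₂ (n !) ≡ m + ν₂ ((l + m) !)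
ν₂-F l n =
  let b , odd , eq = odd-part m n l refl
  in begin
    ν₂ (F l m) + ν₂ (n !)           ≡⟨ ν₂-* (F l m) (n !) {{F≢0 l n}} {{n !≢0}} ⟨
    ν₂ (F l m * n !)                ≡⟨ cong ν₂ eq ⟩
    ν₂ (2 ^ m * (l + m) ! * b)      ≡⟨ cong ν₂ (*-assoc (2 ^ m) ((l + m) !) b) ⟩
    ν₂ (2 ^ m * ((l + m) ! * b))    ≡⟨ ν₂-* (2 ^ m) ((l + m) ! * b) {{m^n≢0 2 m}}
                                         {{m*n≢0 ((l + m) !) b {{(l + m) !≢0}} {{odd⇒nonZero odd}}}} ⟩
    ν₂ (2 ^ m) + ν₂ ((l + m) ! * b) ≡⟨ cong₂ _+_ (ν₂-2^ m) (ν₂-* ((l + m) !) b {{(l + m) !≢0}} {{odd⇒nonZero odd}}) ⟩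
    m + (ν₂ ((l + m) !) + ν₂ b)     ≡⟨ cong (λ x → m + (ν₂ ((l + m) !) + x)) (ν₂-odd b odd) ⟩
    m + (ν₂ ((l + m) !) + 0)        ≡⟨ cong (m +_) (+-identityʳ _) ⟩
    m + ν₂ ((l + m) !)              ∎
  where m = l + n

-- The term of index `suc i` belongs to m = l+i; the `i` in the exponent of 2^m cancels against the
-- denominator `2 ^ i` of `A`.
seqX-value : ∀ l i → seqX l (suc i) ≡ ℤ.+ (l + ν₂ ((2 * l + i) !)) ℤ.- ℤ.+ ν₂ (i !)
seqX-value l i = begin
  seqX l (suc i)
    ≡⟨ cong (λ x → ν₂ℚ (A l x)) (cong pred (+-suc l i)) ⟩
  ν₂ℚ (A l m)
    ≡⟨ ν₂ℚ-ratio (A l m) (F l m) (2 ^ i) {{F≢0 l i}} {{m^n≢0 2 i}} (A-cross l i) ⟩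
  ℤ.+ ν₂ (F l m) ℤ.- ℤ.+ ν₂ (2 ^ i)
    ≡⟨ m+p≡o+n⇒m-n≡o-p (ν₂ (F l m)) (ν₂ (2 ^ i)) (l + ν₂ ((2 * l + i) !)) (ν₂ (i !)) balance ⟩
  ℤ.+ (l + ν₂ ((2 * l + i) !)) ℤ.- ℤ.+ ν₂ (i !) ∎
  where
  m = l + i
  balance : ν₂ (F l m) + ν₂ (i !) ≡ l + ν₂ ((2 * l + i) !) + ν₂ (2 ^ i)
  balance = begin
    ν₂ (F l m) + ν₂ (i !)                  ≡⟨ ν₂-F l i ⟩
    l + i + ν₂ ((l + m) !)                 ≡⟨ cong (λ x → l + i + ν₂ (x !)) (double l i) ⟩
    l + i + ν₂ ((2 * l + i) !)             ≡⟨ swap l i (ν₂ ((2 * l + i) !)) ⟩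
    l + ν₂ ((2 * l + i) !) + i             ≡⟨ cong (l + ν₂ ((2 * l + i) !) +_) (ν₂-2^ i) ⟨
    l + ν₂ ((2 * l + i) !) + ν₂ (2 ^ i)    ∎
    where
    double : ∀ l i → l + (l + i) ≡ 2 * l + i
    double = solve-∀
    swap : ∀ l i x → l + i + x ≡ l + x + i
    swap = solve-∀

-- Consecutive terms and block structure

ν₂-suc! : ∀ n → ν₂ (suc n !) ≡ ν₂ (suc n) + ν₂ (n !)
ν₂-suc! n = ν₂-* (suc n) (n !) {{_}} {{n !≢0}}

module _ (l i : ℕ) where
  private
    -- The summand common to both sides once the differences for two consecutive terms are
    -- cross-added; beyond it remain the valuations of the new factors `2 * l + suc i` and `suc i`
    -- of the factorials.
    K : ℕ
    K = l + ν₂ ((2 * l + i) !) + ν₂ (i !)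

    upper : l + ν₂ ((2 * l + suc i) !) + ν₂ (i !) ≡ ν₂ (2 * l + suc i) + K
    upper rewrite +-suc (2 * l) i = trans
      (cong (λ x → l + x + ν₂ (i !)) (ν₂-suc! (2 * l + i)))
      (shuffle l (ν₂ (suc (2 * l + i))) (ν₂ ((2 * l + i) !)) (ν₂ (i !)))
      where
      shuffle : ∀ l a w b → l + (a + w) + b ≡ a + (l + w + b)
      shuffle = solve-∀

    lower : l + ν₂ ((2 * l + i) !) + ν₂ (suc i !) ≡ ν₂ (suc i) + K
    lower = trans
      (cong (l + ν₂ ((2 * l + i) !) +_) (ν₂-suc! i))
      (shuffle (l + ν₂ ((2 * l + i) !)) (ν₂ (suc i)) (ν₂ (i !)))
      where
      shuffle : ∀ x a b → x + (a + b) ≡ a + (x + b)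
      shuffle = solve-∀

  ν₂≡⇒seqX≡ : ν₂ (2 * l + suc i) ≡ ν₂ (suc i) → seqX l (2 + i) ≡ seqX l (suc i)
  ν₂≡⇒seqX≡ eq = trans (seqX-value l (suc i)) (trans
    (m+p≡o+n⇒m-n≡o-p (l + ν₂ ((2 * l + suc i) !)) (ν₂ (suc i !)) (l + ν₂ ((2 * l + i) !)) (ν₂ (i !))
      (trans upper (trans (cong (_+ K) eq) (sym lower))))
    (sym (seqX-value l i)))

  seqX≡⇒ν₂≡ : seqX l (2 + i) ≡ seqX l (suc i) → ν₂ (2 * l + suc i) ≡ ν₂ (suc i)
  seqX≡⇒ν₂≡ eq = +-cancelʳ-≡ K _ _ (trans (sym upper) (trans
    (m-n≡o-p⇒m+p≡o+n (l + ν₂ ((2 * l + suc i) !)) (ν₂ (suc i !)) (l + ν₂ ((2 * l + i) !)) (ν₂ (i !))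
      (trans (sym (seqX-value l (suc i))) (trans eq (seqX-value l i))))
    lower))

mainTheorem11 : ∀ (l : ℕ) → 1 ≤ l → IsSimple (seqX l) (2 ^ (1 + ν₂ l))
mainTheorem11 l 1≤l =
  -- With `c` the odd part of `l`, the shift `2 * l` is the odd multiple `s * c` of `s`.
  let c , odd , l≡ = oddPart l {{>-nonZero 1≤l}} in
  simple c odd (trans (cong (2 *_) l≡) (sym (*-assoc 2 (2 ^ ν₂ l) c)))
  where
  v = 1 + ν₂ l
  s = 2 ^ v

  simple : ∀ c → ¬ (2 ∣ c) → 2 * l ≡ s * c → IsSimple (seqX l) s
  simple c odd 2l≡sc = (*-monoʳ-≤ 2 (m^n>0 2 (ν₂ l)) , block) , largest
    where
    -- Both arguments are congruent to `j` modulo `s = 2 ^ v`, and 0 < j < s.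
    same-valuation : ∀ t j → 1 ≤ j → j < s → ν₂ (2 * l + (s * t + j)) ≡ ν₂ (s * t + j)
    same-valuation t j 1≤j j<s = begin
      ν₂ (2 * l + (s * t + j))   ≡⟨ cong (λ x → ν₂ (x + (s * t + j))) 2l≡sc ⟩
      ν₂ (s * c + (s * t + j))   ≡⟨ cong ν₂ (regroup s c t j) ⟩
      ν₂ (s * (c + t) + j)       ≡⟨ ν₂-+-multiple v (c + t) j 1≤j j<s ⟩
      ν₂ j                       ≡⟨ ν₂-+-multiple v t j 1≤j j<s ⟨
      ν₂ (s * t + j)             ∎
      where
      regroup : ∀ s c t j → s * c + (s * t + j) ≡ s * (c + t) + j
      regroup = solve-∀

    block : ∀ t i → 1 ≤ i → i ≤ s → seqX l (s * t + i) ≡ seqX l (s * t + 1)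
    block t (suc zero)      _ _     = refl
    block t (suc j@(suc k)) _ 1+j≤s = begin
      seqX l (s * t + suc j)       ≡⟨ cong (seqX l) (trans (+-suc (s * t) j) (cong suc (+-suc (s * t) k))) ⟩
      seqX l (2 + (s * t + k))     ≡⟨ ν₂≡⇒seqX≡ l (s * t + k)
                                        (subst (λ x → ν₂ (2 * l + x) ≡ ν₂ x) (+-suc (s * t) k)
                                          (same-valuation t j z<s 1+j≤s)) ⟩
      seqX l (suc (s * t + k))     ≡⟨ cong (seqX l) (+-suc (s * t) k) ⟨
      seqX l (s * t + j)           ≡⟨ block t j z<s (<⇒≤ 1+j≤s) ⟩
      seqX l (s * t + 1)           ∎

    -- The product `c * suc c` is even and `c` is odd.
    2∣1+c : 2 ∣ suc c
    2∣1+c = [ ⊥-elim ∘ odd , (λ d → d) ]′ (euclidsLemma c (suc c) prime[2] (2∣n*[n+1] c))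

    2s∣2l+s : 2 ^ suc v ∣ 2 * l + s
    2s∣2l+s = subst₂ _∣_ (*-comm s 2) (trans (distrib s c) (cong (_+ s) (sym 2l≡sc))) (*-monoʳ-∣ s 2∣1+c)
      where
      distrib : ∀ s c → s * (1 + c) ≡ s * c + s
      distrib = solve-∀

    -- Equality would force `ν₂ (2 * l + s) ≡ v`, although 2l+s = s(c+1) is divisible by 2s. The
    -- equation with `suc k` supplies the successor form of the index.
    jump : ∀ k → s ≡ suc k → ¬ (seqX l (suc s) ≡ seqX l s)
    jump k s≡1+k eq = ν₂-maximal (2 * l + s) {{≢-nonZero λ z → 1+n≢0 (trans (sym s≡1+k) (m+n≡0⇒n≡0 (2 * l) z))}}
      (subst (λ x → 2 ^ suc x ∣ 2 * l + s) (sym ν≡v) 2s∣2l+s)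
      where
      ν≡v : ν₂ (2 * l + s) ≡ v
      ν≡v = trans
        (subst (λ x → seqX l (suc x) ≡ seqX l x → ν₂ (2 * l + x) ≡ ν₂ x) (sym s≡1+k) (seqX≡⇒ν₂≡ l k) eq)
        (ν₂-2^ v)

    largest : ∀ r → HasBlockStructure (seqX l) r → r ≤ s
    largest r (_ , constant) = ≮⇒≥ λ s<r →
      -- A longer block length would put both `s` and `suc s` into the block `t = 0`, against
      -- `jump`.
      let at : ∀ i → 1 ≤ i → i ≤ r → seqX l i ≡ seqX l 1
          at i 1≤i i≤r = subst (λ x → seqX l (x + i) ≡ seqX l (x + 1)) (*-zeroʳ r) (constant 0 i 1≤i i≤r)
      in jump (pred s) (sym (suc-pred s {{m^n≢0 2 v}}))
           (trans (at (suc s) z<s s<r) (sym (at s (m^n>0 2 v) (<⇒≤ s<r))))
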